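{- The reductions $\to_w$ and $\to_{w\neg gcv} := \to_{wm}\cup\to_{we}$ of the silly substitution calculus are confluent.
   Context: Terms: $t,u,s ::= x \mid \lambda x.t \mid t\,u \mid t[x\backslash u]$, where $t[x\backslash u]$ is an explicit substitution binding $x$ in $t$; terms up to $\alpha$-renaming; $\mathrm{fv}(t[x\backslash u]) = (\mathrm{fv}(t)\setminus\{x\})\cup \mathrm{fv}(u)$. Values: $v ::= \lambda x.t$. Substitution contexts: $S ::= \langle\cdot\rangle \mid S[x\backslash u]$. Weak contexts: $W ::= \langle\cdot\rangle \mid W\,t \mid t\,W \mid t[x\backslash W] \mid W[x\backslash u]$. $W\langle\langle t\rangle\rangle$ denotes plugging $t$ in $W$ where $W$ does not capture free variables of $t$. Root rules: $S\langle \lambda x.t\rangle u \mapsto_m S\langle t[x\backslash u]\rangle$; $W\langle\langle x\rangle\rangle[x\backslash u] \mapsto_{e} W\langle\langle u\rangle\rangle[x\backslash u]$ ($W$ weak context); $t[x\backslash S\langle v\rangle] \mapsto_{gcv} S\langle t\rangle$ if $x\notin\mathrm{fv}(t)$. $\to_{wm},\to_{we},\to_{wgcv}$ are their closures under weak contexts; $\to_w$ is their union. A relation $\to$ is confluent if whenever $t\to^* u_1$ and $t\to^* u_2$ there is $s$ with $u_1\to^* s$ and $u_2\to^* s$. -}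

module Defs where

open import Data.Nat.Base using (ℕ; suc)
open import Data.Fin.Base using (Fin; zero; suc; punchOut)
open import Function.Base using (id; _∘_)
open import Level using (0ℓ)
open import Relation.Binary.Core using (Rel)
open import Relation.Binary.Construct.Union using (_∪_)
open import Relation.Binary.PropositionalEquality.Core using (refl)
open import Relation.Nullary.Negation.Core using (¬_)

private
  variable
    n m : ℕ

infixr 5 ƛ_
infixl 7 _·_
infixl 8 _[x∖_]

-- Terms up to α-renaming, as well-scoped de Bruijn terms: the elements of
-- Term n are the terms whose free variables are among n given ones.  Both
-- ƛ t and t [x∖ u ] bind index zero in t; the latter binds nothing in u.

data Term (n : ℕ) : Set where
  var    : Fin n → Term n
  ƛ_     : Term (suc n) → Term n
  _·_    : Term n → Term n → Term n
  _[x∖_] : Term (suc n) → Term n → Term n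

data Value {n : ℕ} : Term n → Set where
  ƛ_ : (t : Term (suc n)) → Value (ƛ t)

data _∈fv_ {n : ℕ} (x : Fin n) : Term n → Set where
  var  : x ∈fv var x
  ƛ_   : ∀ {t} → suc x ∈fv t → x ∈fv (ƛ t)
  appˡ : ∀ {t u} → x ∈fv t → x ∈fv (t · u)
  appʳ : ∀ {t u} → x ∈fv u → x ∈fv (t · u)
  subˡ : ∀ {t u} → suc x ∈fv t → x ∈fv (t [x∖ u ])
  subʳ : ∀ {t u} → x ∈fv u → x ∈fv (t [x∖ u ])

_∉fv_ : Fin n → Term n → Set
x ∉fv t = ¬ (x ∈fv t)

ext : (Fin n → Fin m) → Fin (suc n) → Fin (suc m)
ext ρ zero    = zero
ext ρ (suc x) = suc (ρ x)

rename : (Fin n → Fin m) → Term n → Term m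
rename ρ (var x)      = var (ρ x)
rename ρ (ƛ t)        = ƛ rename (ext ρ) t
rename ρ (t · u)      = rename ρ t · rename ρ u
rename ρ (t [x∖ u ])  = rename (ext ρ) t [x∖ rename ρ u ]

-- The same term, seen in the scope from which the non-free variable x has
-- been removed.

strengthen : (x : Fin (suc n)) (t : Term (suc n)) → x ∉fv t → Term n
strengthen x (var y)     x∉ = var (punchOut {i = x} {j = y} λ { refl → x∉ var })
strengthen x (ƛ t)       x∉ = ƛ strengthen (suc x) t (x∉ ∘ ƛ_)
strengthen x (t · u)     x∉ = strengthen x t (x∉ ∘ appˡ) · strengthen x u (x∉ ∘ appʳ)
strengthen x (t [x∖ u ]) x∉ = strengthen (suc x) t (x∉ ∘ subˡ) [x∖ strengthen x u (x∉ ∘ subʳ) ]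

-- In SCtx n m and WCtx n m, n is the scope of the whole context and m the
-- scope of its hole.

data SCtx : ℕ → ℕ → Set where
  ⟨·⟩    : SCtx n n
  _[x∖_] : SCtx (suc n) m → Term n → SCtx n m

data WCtx : ℕ → ℕ → Set where
  ⟨·⟩     : WCtx n n
  _·ˡ_    : WCtx n m → Term n → WCtx n m
  _·ʳ_    : Term n → WCtx n m → WCtx n m
  _[x∖_]ʳ : Term (suc n) → WCtx n m → WCtx n m
  _[x∖_]ˡ : WCtx (suc n) m → Term n → WCtx n m

-- Possibly capturing plugging.

_⟨_⟩ˢ : SCtx n m → Term m → Term n
⟨·⟩         ⟨ t ⟩ˢ = t
(S [x∖ u ]) ⟨ t ⟩ˢ = (S ⟨ t ⟩ˢ) [x∖ u ]

_⟨_⟩ʷ : WCtx n m → Term m → Term n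
⟨·⟩          ⟨ t ⟩ʷ = t
(W ·ˡ u)     ⟨ t ⟩ʷ = (W ⟨ t ⟩ʷ) · u
(u ·ʳ W)     ⟨ t ⟩ʷ = u · (W ⟨ t ⟩ʷ)
(u [x∖ W ]ʳ) ⟨ t ⟩ʷ = u [x∖ W ⟨ t ⟩ʷ ]
(W [x∖ u ]ˡ) ⟨ t ⟩ʷ = (W ⟨ t ⟩ʷ) [x∖ u ]

-- The variables in scope outside a context, as seen from its hole.

embˢ : SCtx n m → Fin n → Fin m
embˢ ⟨·⟩         = id
embˢ (S [x∖ _ ]) = embˢ S ∘ suc

embʷ : WCtx n m → Fin n → Fin m
embʷ ⟨·⟩          = id
embʷ (W ·ˡ _)     = embʷ W
embʷ (_ ·ʳ W)     = embʷ W
embʷ (_ [x∖ W ]ʳ) = embʷ W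
embʷ (W [x∖ _ ]ˡ) = embʷ W ∘ suc

-- Capture-avoiding plugging: t lives in the outer scope, so no variable of t
-- is captured.

_⟪_⟫ˢ : SCtx n m → Term n → Term n
S ⟪ t ⟫ˢ = S ⟨ rename (embˢ S) t ⟩ˢ

_⟪_⟫ʷ : WCtx n m → Term n → Term n
W ⟪ t ⟫ʷ = W ⟨ rename (embʷ W) t ⟩ʷ

-- Root rules.  By the convention on bound names, S captures no variable of
-- u in ↦m and no variable of t in ↦gcv.

data _↦m_ {n : ℕ} : Rel (Term n) 0ℓ where
  root-m : (S : SCtx n m) (t : Term (suc m)) (u : Term n) →
           ((S ⟨ ƛ t ⟩ˢ) · u) ↦m (S ⟨ t [x∖ rename (embˢ S) u ] ⟩ˢ)

data _↦e_ {n : ℕ} : Rel (Term n) 0ℓ where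
  root-e : (W : WCtx (suc n) m) (u : Term n) →
           ((W ⟪ var zero ⟫ʷ) [x∖ u ]) ↦e ((W ⟪ rename suc u ⟫ʷ) [x∖ u ])

data _↦gcv_ {n : ℕ} : Rel (Term n) 0ℓ where
  root-gcv : (t : Term (suc n)) (S : SCtx n m) {v : Term m} → Value v →
             (x∉t : zero ∉fv t) →
             (t [x∖ S ⟨ v ⟩ˢ ]) ↦gcv (S ⟪ strengthen zero t x∉t ⟫ˢ)

data WeakClosure (R : ∀ {k} → Rel (Term k) 0ℓ) {n : ℕ} : Rel (Term n) 0ℓ where
  close : (W : WCtx n m) {t u : Term m} → R t u →
          WeakClosure R (W ⟨ t ⟩ʷ) (W ⟨ u ⟩ʷ)

_→wm_ _→we_ _→wgcv_ _→w_ _→w¬gcv_ : Rel (Term n) 0ℓ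
_→wm_    = WeakClosure _↦m_
_→we_    = WeakClosure _↦e_
_→wgcv_  = WeakClosure _↦gcv_
_→w_     = _→wm_ ∪ _→we_ ∪ _→wgcv_
_→w¬gcv_ = _→wm_ ∪ _→we_

{-# OPTIONS --safe #-}

-- The exponential rule alone is confluent because the term obtained by
-- unfolding all explicit substitutions at weak positions (and keeping them) is
-- reachable by exponential steps and invariant under them.  The other two rules
-- act on answers S⟨v⟩ and never duplicate or erase a redex, as no redex lies
-- inside a value; their parallel version has the diamond property and commutes
-- in one-one squares with single exponential steps.  The Hindley–Rosen lemma
-- concludes.

module Submission where

open import Defs
open import Data.Empty using (⊥)
open import Data.Fin.Base using (Fin; zero; suc; punchIn)
open import Data.Fin.Properties using (suc-injective; punchIn-punchOut)
open import Data.Nat.Base using (ℕ; suc)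
open import Data.Product.Base using (_×_; _,_; ∃; ∃₂)
open import Data.Sum.Base using (_⊎_; inj₁; inj₂)
open import Data.Unit.Base using (⊤; tt)
open import Function.Base using (id; _∘_)
open import Level using (0ℓ)
open import Relation.Binary.Core using (Rel; _⇒_)
open import Relation.Binary.Construct.Closure.ReflexiveTransitive using (Star; ε; _◅_; _◅◅_; gmap; map; return; _⋆)
open import Relation.Binary.Construct.Union using (_∪_)
open import Relation.Binary.PropositionalEquality.Core using (_≡_; refl; sym; trans; cong; cong₂; subst; _≗_)
open import Relation.Binary.Rewriting using (Confluent)

private
  variable
    n m k l : ℕ

infixl 6 _▸_
infix 4 _⊢_⇝_ _⊨_∶_

-- Abstract rewriting

module _ {A : Set} where

  Square : Rel A 0ℓ → Rel A 0ℓ → Set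
  Square R S = ∀ {a b c} → R a b → S a c → ∃ λ d → S b d × R c d

  -- Each side of the basic square is exactly one step, so squares can be pasted along the
  -- `S`-sequence by plain induction, with no termination measure.
  square-strip : ∀ {R S} → Square R S → Square R (Star S)
  square-strip sq r ε        = _ , ε , r
  square-strip sq r (s ◅ ss) with sq r s
  ... | _ , s′ , r′ with square-strip sq r′ ss
  ... | d , ss′ , r″ = d , s′ ◅ ss′ , r″

  square-star : ∀ {R S} → Square R S → Square (Star R) (Star S)
  square-star sq ε        ss = _ , ss , ε
  square-star sq (r ◅ rs) ss with square-strip sq r ss
  ... | _ , ss′ , r′ with square-star sq rs ss′
  ... | d , ss″ , rs′ = d , ss″ , r′ ◅ rs′

  -- The hypotheses make the two reflexive-transitive closures coincide. This allows passing from
  -- the weak closures to relations that are easier to tile.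
  confluent-transfer : ∀ {R S : Rel A 0ℓ} → R ⇒ Star S → S ⇒ Star R →
                       Confluent S → Confluent R
  confluent-transfer f g conf p q with conf ((f ⋆) p) ((f ⋆) q)
  ... | d , p′ , q′ = d , (g ⋆) p′ , (g ⋆) q′

  -- An `R`-sequence followed by an `S`-sequence is a relation between `R ∪ S` and its closure, and
  -- it has the diamond property.
  hindley-rosen : ∀ {R S : Rel A 0ℓ} → Confluent R → Confluent S →
                  Square (Star R) (Star S) → Confluent (R ∪ S)
  hindley-rosen {R} {S} confR confS comm =
    confluent-transfer
      (λ { (inj₁ r) → return (_ , return r , ε)
         ; (inj₂ s) → return (_ , ε , return s) })
      (λ { (_ , rs , ss) → map inj₁ rs ◅◅ map inj₂ ss })
      (square-star diamond)
    where
    diamond : Square (λ a b → ∃ λ c → Star R a c × Star S c b)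
                     (λ a b → ∃ λ c → Star R a c × Star S c b)
    -- Four tiles: confluence of `R` at the source, a commutation on either side, confluence of `S`
    -- at the far corner.
    diamond (_ , r₁ , s₁) (_ , r₂ , s₂) with confR r₁ r₂
    ... | _ , r₁′ , r₂′ with comm r₁′ s₁ | comm r₂′ s₂
    ... | _ , s₁′ , r₁″ | _ , s₂′ , r₂″ with confS s₁′ s₂′
    ... | d , s₁″ , s₂″ = d , (_ , r₁″ , s₁″) , (_ , r₂″ , s₂″)

-- Renaming

wk : Term n → Term (suc n)
wk = rename suc

ext-cong : {ρ ρ′ : Fin n → Fin m} → ρ ≗ ρ′ → ext ρ ≗ ext ρ′
ext-cong eq zero    = refl
ext-cong eq (suc x) = cong suc (eq x)

rename-cong : {ρ ρ′ : Fin n → Fin m} → ρ ≗ ρ′ → rename ρ ≗ rename ρ′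
rename-cong eq (var x)     = cong var (eq x)
rename-cong eq (ƛ t)       = cong ƛ_ (rename-cong (ext-cong eq) t)
rename-cong eq (t · u)     = cong₂ _·_ (rename-cong eq t) (rename-cong eq u)
rename-cong eq (t [x∖ u ]) =
  cong₂ _[x∖_] (rename-cong (ext-cong eq) t) (rename-cong eq u)

rename-∘ : {ρ : Fin n → Fin m} {π : Fin m → Fin k} {χ : Fin n → Fin k} →
           π ∘ ρ ≗ χ → rename π ∘ rename ρ ≗ rename χ
rename-∘ {ρ = ρ} {π} {χ} eq = go
  where
  eq′ : ext π ∘ ext ρ ≗ ext χ
  eq′ zero    = refl
  eq′ (suc x) = cong suc (eq x)

  go : rename π ∘ rename ρ ≗ rename χ
  go (var x)     = cong var (eq x)
  go (ƛ t)       = cong ƛ_ (rename-∘ eq′ t)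
  go (t · u)     = cong₂ _·_ (go t) (go u)
  go (t [x∖ u ]) = cong₂ _[x∖_] (rename-∘ eq′ t) (go u)

ext-id : {ρ : Fin n → Fin n} → ρ ≗ id → ext ρ ≗ id
ext-id eq zero    = refl
ext-id eq (suc x) = cong suc (eq x)

rename-id : {ρ : Fin n → Fin n} → ρ ≗ id → rename ρ ≗ id
rename-id eq (var x)     = cong var (eq x)
rename-id eq (ƛ t)       = cong ƛ_ (rename-id (ext-id eq) t)
rename-id eq (t · u)     = cong₂ _·_ (rename-id eq t) (rename-id eq u)
rename-id eq (t [x∖ u ]) = cong₂ _[x∖_] (rename-id (ext-id eq) t) (rename-id eq u)

rename-ext-wk : (ρ : Fin n → Fin m) (t : Term n) →
                rename (ext ρ) (wk t) ≡ wk (rename ρ t)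
rename-ext-wk ρ t =
  trans (rename-∘ (λ _ → refl) t) (sym (rename-∘ (λ _ → refl) t))

-- The existence half of the universal property, on elements.
IsPullback : (Fin n → Fin l) → (Fin m → Fin l) → (Fin k → Fin n) → (Fin k → Fin m) → Set
IsPullback ρ π α β = ∀ x y → ρ x ≡ π y → ∃ λ z → x ≡ α z × y ≡ β z

ext-pullback : {ρ : Fin n → Fin l} {π : Fin m → Fin l} {α : Fin k → Fin n} {β : Fin k → Fin m} →
               IsPullback ρ π α β → IsPullback (ext ρ) (ext π) (ext α) (ext β)
ext-pullback pb zero    zero    _  = zero , refl , refl
ext-pullback pb (suc x) (suc y) eq with pb x y (suc-injective eq)
... | z , refl , refl = suc z , refl , refl

ƛ-injective : {t t′ : Term (suc n)} → _≡_ {A = Term n} (ƛ t) (ƛ t′) → t ≡ t′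
ƛ-injective refl = refl

·-injective : {t t′ u u′ : Term n} → t · u ≡ t′ · u′ → t ≡ t′ × u ≡ u′
·-injective refl = refl , refl

sub-injective : {t t′ : Term (suc n)} {u u′ : Term n} →
                t [x∖ u ] ≡ t′ [x∖ u′ ] → t ≡ t′ × u ≡ u′
sub-injective refl = refl , refl

var-injective : {x y : Fin n} → var x ≡ var y → x ≡ y
var-injective refl = refl

-- The action of renamings on terms inherits the property from variables. It gives both the
-- injectivity of `wk` and the reflection of freshness along renamings.
rename-pullback : {ρ : Fin n → Fin l} {π : Fin m → Fin l} {α : Fin k → Fin n} {β : Fin k → Fin m} →
                  IsPullback ρ π α β → ∀ t u → rename ρ t ≡ rename π u →
                  ∃ λ s → t ≡ rename α s × u ≡ rename β s
rename-pullback pb (var x) (var y) eq with pb x y (var-injective eq)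
... | z , refl , refl = var z , refl , refl
rename-pullback pb (ƛ t) (ƛ u) eq
  with rename-pullback (ext-pullback pb) t u (ƛ-injective eq)
... | s , refl , refl = ƛ s , refl , refl
rename-pullback pb (t · t′) (u · u′) eq with ·-injective eq
... | eq₁ , eq₂ with rename-pullback pb t u eq₁ | rename-pullback pb t′ u′ eq₂
... | s , refl , refl | s′ , refl , refl = s · s′ , refl , refl
rename-pullback pb (t [x∖ t′ ]) (u [x∖ u′ ]) eq with sub-injective eq
... | eq₁ , eq₂ with rename-pullback (ext-pullback pb) t u eq₁ | rename-pullback pb t′ u′ eq₂
... | s , refl , refl | s′ , refl , refl = s [x∖ s′ ] , refl , refl

wk-injective : {t u : Term n} → wk t ≡ wk u → t ≡ u
wk-injective {t = t} {u} eq
  with rename-pullback {α = id} {β = id} (λ x y e → x , refl , sym (suc-injective e)) t u eq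
... | s , refl , refl = refl

rename-ext-wk⁻¹ : (ρ : Fin n → Fin m) (t : Term (suc n)) {u : Term m} →
                  rename (ext ρ) t ≡ wk u → ∃ λ s → t ≡ wk s × u ≡ rename ρ s
rename-ext-wk⁻¹ ρ t {u} = rename-pullback pb t u
  where
  pb : IsPullback (ext ρ) suc suc ρ
  pb (suc x) y eq = x , refl , sym (suc-injective eq)

-- Structural forms of the root rules

-- Beta f u r holds when f · u ↦m r.
data Beta {n : ℕ} : Term n → Term n → Term n → Set where
  lam : ∀ {t u} → Beta (ƛ t) u (t [x∖ u ])
  sub : ∀ {f u r s} → Beta f (wk u) r → Beta (f [x∖ s ]) u (r [x∖ s ])

-- Collect t a r holds when wk t [x∖ a ] ↦gcv r.
data Collect {n : ℕ} : Term n → Term n → Term n → Set where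
  lam : ∀ {t b} → Collect t (ƛ b) t
  sub : ∀ {t a r s} → Collect (wk t) a r → Collect t (a [x∖ s ]) (r [x∖ s ])

beta-deterministic : {f u r r′ : Term n} → Beta f u r → Beta f u r′ → r ≡ r′
beta-deterministic lam     lam     = refl
beta-deterministic (sub b) (sub c) = cong _[x∖ _ ] (beta-deterministic b c)

collect-deterministic : {t a r r′ : Term n} → Collect t a r → Collect t a r′ → r ≡ r′
collect-deterministic lam     lam     = refl
collect-deterministic (sub c) (sub d) = cong _[x∖ _ ] (collect-deterministic c d)

beta-rename : (ρ : Fin n → Fin m) {f u r : Term n} → Beta f u r →
              Beta (rename ρ f) (rename ρ u) (rename ρ r)
beta-rename ρ lam             = lam
beta-rename ρ (sub {u = u} b) =
  sub (subst (λ v → Beta _ v _) (rename-ext-wk ρ u) (beta-rename (ext ρ) b))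

collect-rename : (ρ : Fin n → Fin m) {t a r : Term n} → Collect t a r →
                 Collect (rename ρ t) (rename ρ a) (rename ρ r)
collect-rename ρ lam             = lam
collect-rename ρ (sub {t = t} c) =
  sub (subst (λ v → Collect v _ _) (rename-ext-wk ρ t) (collect-rename (ext ρ) c))

beta-rename⁻¹ : (ρ : Fin n → Fin m) (f u : Term n) {r : Term m} →
                Beta (rename ρ f) (rename ρ u) r → ∃ λ s → r ≡ rename ρ s × Beta f u s
beta-rename⁻¹ ρ (ƛ t)       u lam     = _ , refl , lam
beta-rename⁻¹ ρ (f [x∖ s ]) u (sub b)
  with beta-rename⁻¹ (ext ρ) f (wk u) (subst (λ v → Beta _ v _) (sym (rename-ext-wk ρ u)) b)
... | _ , refl , b′ = _ , refl , sub b′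

collect-rename⁻¹ : (ρ : Fin n → Fin m) (t a : Term n) {r : Term m} →
                   Collect (rename ρ t) (rename ρ a) r →
                   ∃ λ s → r ≡ rename ρ s × Collect t a s
collect-rename⁻¹ ρ t (ƛ b)       lam     = _ , refl , lam
collect-rename⁻¹ ρ t (a [x∖ s ]) (sub c)
  with collect-rename⁻¹ (ext ρ) (wk t) a (subst (λ v → Collect v _ _) (sym (rename-ext-wk ρ t)) c)
... | _ , refl , c′ = _ , refl , sub c′

-- `f′` is `f` moved under the substitution context of `s`, and a multiplicative step sees through
-- such contexts.
beta-collect : {f u r s f′ : Term n} → Beta f u r → Collect f s f′ →
               ∃ λ r′ → Beta f′ u r′ × Collect r s r′
beta-collect b lam     = _ , b , lam
beta-collect b (sub c) with beta-collect (beta-rename suc b) c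
... | _ , b′ , c′ = _ , sub b′ , sub c′

-- Nested substitution contexts are flattened to the same list in either order.
collect-collect : {t a r s a′ : Term n} → Collect t a r → Collect a s a′ →
                  ∃ λ r′ → Collect t a′ r′ × Collect r s r′
collect-collect c lam     = _ , c , lam
collect-collect c (sub d) with collect-collect (collect-rename suc c) d
... | _ , c′ , d′ = _ , sub c′ , sub d′

-- Parallel multiplicative and garbage collection steps

-- Garbage collection is available only if G is inhabited.
data Par (G : Set) {n : ℕ} : Rel (Term n) 0ℓ where
  var  : ∀ x → Par G (var x) (var x)
  lam  : ∀ t → Par G (ƛ t) (ƛ t)
  app  : ∀ {t t′ u u′} → Par G t t′ → Par G u u′ → Par G (t · u) (t′ · u′)
  sub  : ∀ {t t′ u u′} → Par G t t′ → Par G u u′ → Par G (t [x∖ u ]) (t′ [x∖ u′ ])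
  beta : ∀ {f f′ u u′ r} → Par G f f′ → Par G u u′ → Beta f′ u′ r → Par G (f · u) r
  -- Freshness of the bound variable, expressed as being a weakening, is asked of the reduct `t′`:
  -- steps inside `t` may erase values in which the variable occurs.
  gc   : ∀ {t t′ s a a′ r} → G → Par G t t′ → t′ ≡ wk s → Par G a a′ → Collect s a′ r →
         Par G (t [x∖ a ]) r

module _ {G : Set} where

  par-refl : (t : Term n) → Par G t t
  par-refl (var x)     = var x
  par-refl (ƛ t)       = lam t
  par-refl (t · u)     = app (par-refl t) (par-refl u)
  par-refl (t [x∖ u ]) = sub (par-refl t) (par-refl u)

  par-rename : (ρ : Fin n → Fin m) {t t′ : Term n} → Par G t t′ →
               Par G (rename ρ t) (rename ρ t′)
  par-rename ρ (var x)       = var (ρ x)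
  par-rename ρ (lam t)       = lam _
  par-rename ρ (app p q)     = app (par-rename ρ p) (par-rename ρ q)
  par-rename ρ (sub p q)     = sub (par-rename (ext ρ) p) (par-rename ρ q)
  par-rename ρ (beta p q b)  = beta (par-rename ρ p) (par-rename ρ q) (beta-rename ρ b)
  par-rename ρ (gc {s = s} g p refl q c) =
    gc g (par-rename (ext ρ) p) (rename-ext-wk ρ s) (par-rename ρ q) (collect-rename ρ c)

  -- Steps introduce no free variable and renaming creates no redex. For `suc` this says that
  -- freshness of a variable survives reduction.
  par-rename⁻¹ : (ρ : Fin n → Fin m) (t : Term n) {r : Term m} → Par G (rename ρ t) r →
                 ∃ λ s → r ≡ rename ρ s × Par G t s
  par-rename⁻¹ ρ (var x)     (var _)   = _ , refl , var x
  par-rename⁻¹ ρ (ƛ t)       (lam _)   = _ , refl , lam t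
  par-rename⁻¹ ρ (t · u)     (app p q) with par-rename⁻¹ ρ t p | par-rename⁻¹ ρ u q
  ... | _ , refl , p′ | _ , refl , q′ = _ , refl , app p′ q′
  par-rename⁻¹ ρ (t · u)     (beta p q b) with par-rename⁻¹ ρ t p | par-rename⁻¹ ρ u q
  ... | f , refl , p′ | v , refl , q′ with beta-rename⁻¹ ρ f v b
  ... | _ , refl , b′ = _ , refl , beta p′ q′ b′
  par-rename⁻¹ ρ (t [x∖ u ]) (sub p q) with par-rename⁻¹ (ext ρ) t p | par-rename⁻¹ ρ u q
  ... | _ , refl , p′ | _ , refl , q′ = _ , refl , sub p′ q′
  par-rename⁻¹ ρ (t [x∖ u ]) (gc g p eq q c)
    with par-rename⁻¹ (ext ρ) t p | par-rename⁻¹ ρ u q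
  ... | t′ , refl , p′ | a , refl , q′ with rename-ext-wk⁻¹ ρ t′ eq
  ... | s , refl , refl with collect-rename⁻¹ ρ s a c
  ... | _ , refl , c′ = _ , refl , gc g p′ refl q′ c′

  -- Since values do not reduce, steps in the answer `f` only affect its substitution context, and
  -- `f′` is again an answer.
  par-beta : {f f′ u u′ r : Term n} → Beta f u r → Par G f f′ → Par G u u′ →
             ∃ λ r′ → Beta f′ u′ r′ × Par G r r′
  par-beta lam     (lam t)         q = _ , lam , sub (par-refl t) q
  par-beta (sub b) (sub p o)       q with par-beta b p (par-rename suc q)
  ... | _ , b′ , p′ = _ , sub b′ , sub p′ o
  -- The outer substitution of `f` is collected. The contractum under it is also a weakening, so the
  -- same collection applies to it.
  par-beta (sub b) (gc g p refl o c) q with par-beta b p (par-rename suc q)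
  ... | _ , b′ , p′ with beta-rename⁻¹ suc _ _ b′
  ... | _ , refl , b″ with beta-collect b″ c
  ... | _ , b‴ , c′ = _ , b‴ , gc g p′ refl o c′

  par-collect : {t t′ a a′ r : Term n} → Collect t a r → Par G t t′ → Par G a a′ →
                ∃ λ r′ → Collect t′ a′ r′ × Par G r r′
  par-collect lam     p (lam _)   = _ , lam , p
  par-collect (sub c) p (sub q o) with par-collect c (par-rename suc p) q
  ... | _ , c′ , p′ = _ , sub c′ , sub p′ o
  par-collect (sub c) p (gc g q refl o d) with par-collect c (par-rename suc p) q
  ... | _ , c′ , p′ with collect-rename⁻¹ suc _ _ c′
  ... | _ , refl , c″ with collect-collect c″ d
  ... | _ , c‴ , d′ = _ , c‴ , gc g p′ refl o d′

  par-diamond : Square (Par G {n}) (Par G)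
  par-diamond (var x)   (var .x)    = _ , var x , var x
  par-diamond (lam t)   (lam .t)    = _ , lam t , lam t
  par-diamond (app p q) (app p′ q′) with par-diamond p p′ | par-diamond q q′
  ... | _ , p₁ , p₂ | _ , q₁ , q₂ = _ , app p₁ q₁ , app p₂ q₂
  par-diamond (app p q) (beta p′ q′ b) with par-diamond p p′ | par-diamond q q′
  ... | _ , p₁ , p₂ | _ , q₁ , q₂ with par-beta b p₂ q₂
  ... | _ , b′ , r = _ , beta p₁ q₁ b′ , r
  par-diamond (beta p q b) (app p′ q′) with par-diamond p p′ | par-diamond q q′
  ... | _ , p₁ , p₂ | _ , q₁ , q₂ with par-beta b p₁ q₁
  ... | _ , b′ , r = _ , r , beta p₂ q₂ b′
  par-diamond (beta p q b) (beta p′ q′ b′) with par-diamond p p′ | par-diamond q q′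
  ... | _ , p₁ , p₂ | _ , q₁ , q₂ with par-beta b p₁ q₁ | par-beta b′ p₂ q₂
  ... | _ , b₁ , r₁ | _ , b₂ , r₂ with beta-deterministic b₁ b₂
  ... | refl = _ , r₁ , r₂
  par-diamond (sub p q) (sub p′ q′) with par-diamond p p′ | par-diamond q q′
  ... | _ , p₁ , p₂ | _ , q₁ , q₂ = _ , sub p₁ q₁ , sub p₂ q₂
  par-diamond (sub p q) (gc g p′ refl q′ c) with par-diamond p p′ | par-diamond q q′
  -- The common reduct of the body is still a weakening, so garbage collection remains possible
  -- after the other step.
  ... | _ , p₁ , p₂ | _ , q₁ , q₂ with par-rename⁻¹ suc _ p₂
  ... | _ , refl , p₃ with par-collect c p₃ q₂
  ... | _ , c′ , r = _ , gc g p₁ refl q₁ c′ , r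
  par-diamond (gc g p refl q c) (sub p′ q′) with par-diamond p p′ | par-diamond q q′
  ... | _ , p₁ , p₂ | _ , q₁ , q₂ with par-rename⁻¹ suc _ p₁
  ... | _ , refl , p₃ with par-collect c p₃ q₁
  ... | _ , c′ , r = _ , r , gc g p₂ refl q₂ c′
  par-diamond (gc g p refl q c) (gc g′ p′ refl q′ c′) with par-diamond p p′ | par-diamond q q′
  ... | _ , p₁ , p₂ | _ , q₁ , q₂ with par-rename⁻¹ suc _ p₁ | par-rename⁻¹ suc _ p₂
  -- The two sides present the same common reduct as a weakening, hence of the same term.
  ... | _ , refl , p₃ | _ , eq , p₄ with wk-injective eq
  ... | refl with par-collect c p₃ q₁ | par-collect c′ p₄ q₂
  ... | _ , c₁ , r₁ | _ , c₂ , r₂ with collect-deterministic c₁ c₂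
  ... | refl = _ , r₁ , r₂

-- Exponential steps relative to an environment

Env : ℕ → Set
Env n = Fin n → Term n

_▸_ : Env n → Term n → Env (suc n)
(σ ▸ u) zero    = wk u
(σ ▸ u) (suc x) = wk (σ x)

-- One weak occurrence of a variable is replaced by its value, which is either
-- bound by an enclosing explicit substitution or given by σ.  Relative to the
-- environment var this is →we up to identity steps.
data _⊢_⇝_ {n : ℕ} (σ : Env n) : Rel (Term n) 0ℓ where
  var  : ∀ {x s} → σ x ≡ s → σ ⊢ var x ⇝ s
  appˡ : ∀ {t t′ u} → σ ⊢ t ⇝ t′ → σ ⊢ t · u ⇝ t′ · u
  appʳ : ∀ {t u u′} → σ ⊢ u ⇝ u′ → σ ⊢ t · u ⇝ t · u′
  subˡ : ∀ {t t′ u} → σ ▸ u ⊢ t ⇝ t′ → σ ⊢ t [x∖ u ] ⇝ t′ [x∖ u ]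
  subʳ : ∀ {t u u′} → σ ⊢ u ⇝ u′ → σ ⊢ t [x∖ u ] ⇝ t [x∖ u′ ]

-- Compatibility of environments along `ρ`, under which exponential steps and unfolding commute with
-- renaming.
_⊨_∶_ : (Fin n → Fin m) → Env n → Env m → Set
ρ ⊨ σ ∶ τ = ∀ x → τ (ρ x) ≡ rename ρ (σ x)

ext-⊨ : {ρ : Fin n → Fin m} {σ : Env n} {τ : Env m} → ρ ⊨ σ ∶ τ →
        ∀ {u v} → v ≡ rename ρ u → ext ρ ⊨ σ ▸ u ∶ τ ▸ v
ext-⊨ {ρ = ρ} h {u} refl zero = sym (rename-ext-wk ρ u)
ext-⊨ {ρ = ρ} {σ} h eq (suc x) = trans (cong wk (h x)) (sym (rename-ext-wk ρ (σ x)))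

exp-rename : {ρ : Fin n → Fin m} {σ : Env n} {τ : Env m} → ρ ⊨ σ ∶ τ →
             {t t′ : Term n} → σ ⊢ t ⇝ t′ → τ ⊢ rename ρ t ⇝ rename ρ t′
exp-rename h (var refl) = var (h _)
exp-rename h (appˡ e)   = appˡ (exp-rename h e)
exp-rename h (appʳ e)   = appʳ (exp-rename h e)
exp-rename h (subˡ e)   = subˡ (exp-rename (ext-⊨ h refl) e)
exp-rename h (subʳ e)   = subʳ (exp-rename h e)

exp-rename⁻¹ : {ρ : Fin n → Fin m} {σ : Env n} {τ : Env m} → ρ ⊨ σ ∶ τ →
               (t : Term n) {r : Term m} → τ ⊢ rename ρ t ⇝ r →
               ∃ λ s → r ≡ rename ρ s × σ ⊢ t ⇝ s
exp-rename⁻¹ h (var x) (var refl) = _ , h x , var refl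
exp-rename⁻¹ h (t · u) (appˡ e) with exp-rename⁻¹ h t e
... | _ , refl , e′ = _ , refl , appˡ e′
exp-rename⁻¹ h (t · u) (appʳ e) with exp-rename⁻¹ h u e
... | _ , refl , e′ = _ , refl , appʳ e′
exp-rename⁻¹ h (t [x∖ u ]) (subˡ e) with exp-rename⁻¹ (ext-⊨ h refl) t e
... | _ , refl , e′ = _ , refl , subˡ e′
exp-rename⁻¹ h (t [x∖ u ]) (subʳ e) with exp-rename⁻¹ h u e
... | _ , refl , e′ = _ , refl , subʳ e′

exp-wk : {σ : Env n} (u : Term n) {t t′ : Term n} → σ ⊢ t ⇝ t′ → σ ▸ u ⊢ wk t ⇝ wk t′
exp-wk u = exp-rename λ _ → refl

exp-wk⁻¹ : {σ : Env n} {u : Term n} (t : Term n) {r : Term (suc n)} → σ ▸ u ⊢ wk t ⇝ r →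
           ∃ λ s → r ≡ wk s × σ ⊢ t ⇝ s
exp-wk⁻¹ = exp-rename⁻¹ λ _ → refl

-- The case `lam` is empty, as an abstraction has no weak occurrence: the step lies in an argument
-- of the substitution context of `f`, which the contraction keeps exactly once.
exp-betaˡ : {σ : Env n} {f f′ u r : Term n} → Beta f u r → σ ⊢ f ⇝ f′ →
            ∃ λ r′ → Beta f′ u r′ × σ ⊢ r ⇝ r′
exp-betaˡ (sub b) (subˡ e) with exp-betaˡ b e
... | _ , b′ , e′ = _ , sub b′ , subˡ e′
exp-betaˡ (sub b) (subʳ e) = _ , sub b , subʳ e

exp-betaʳ : {σ : Env n} {f u u′ r : Term n} → Beta f u r → σ ⊢ u ⇝ u′ →
            ∃ λ r′ → Beta f u′ r′ × σ ⊢ r ⇝ r′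
exp-betaʳ lam     e = _ , lam , subʳ e
exp-betaʳ (sub b) e with exp-betaʳ b (exp-wk _ e)
... | _ , b′ , e′ = _ , sub b′ , subˡ e′

exp-collectˡ : {σ : Env n} {t t′ a r : Term n} → Collect t a r → σ ⊢ t ⇝ t′ →
               ∃ λ r′ → Collect t′ a r′ × σ ⊢ r ⇝ r′
exp-collectˡ lam     e = _ , lam , e
exp-collectˡ (sub c) e with exp-collectˡ c (exp-wk _ e)
... | _ , c′ , e′ = _ , sub c′ , subˡ e′

exp-collectʳ : {σ : Env n} {t a a′ r : Term n} → Collect t a r → σ ⊢ a ⇝ a′ →
               ∃ λ r′ → Collect t a′ r′ × σ ⊢ r ⇝ r′
exp-collectʳ (sub c) (subˡ e) with exp-collectʳ c e
... | _ , c′ , e′ = _ , sub c′ , subˡ e′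
exp-collectʳ (sub c) (subʳ e) = _ , sub c , subʳ e

module _ {G : Set} where

  ParEnv : Rel (Env n) 0ℓ
  ParEnv σ τ = ∀ x → Par G (σ x) (τ x)

  ▸-par : {σ τ : Env n} {u v : Term n} → ParEnv σ τ → Par G u v → ParEnv (σ ▸ u) (τ ▸ v)
  ▸-par h p zero    = par-rename suc p
  ▸-par h p (suc x) = par-rename suc (h x)

  -- A parallel step neither duplicates nor erases a weak occurrence, so one exponential step stays
  -- one. The value it inserts may have been reduced meanwhile, hence two related environments.
  exp-par : {σ τ : Env n} → ParEnv σ τ → {t t₁ t₂ : Term n} → σ ⊢ t ⇝ t₁ → Par G t t₂ →
            ∃ λ r → Par G t₁ r × τ ⊢ t₂ ⇝ r
  exp-par h (var refl) (var x)   = _ , h x , var refl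
  exp-par h (appˡ e)   (app p q) with exp-par h e p
  ... | _ , p′ , e′ = _ , app p′ q , appˡ e′
  exp-par h (appʳ e)   (app p q) with exp-par h e q
  ... | _ , q′ , e′ = _ , app p q′ , appʳ e′
  exp-par h (appˡ e)   (beta p q b) with exp-par h e p
  ... | _ , p′ , e′ with exp-betaˡ b e′
  ... | _ , b′ , e″ = _ , beta p′ q b′ , e″
  exp-par h (appʳ e)   (beta p q b) with exp-par h e q
  ... | _ , q′ , e′ with exp-betaʳ b e′
  ... | _ , b′ , e″ = _ , beta p q′ b′ , e″
  exp-par h (subˡ e)   (sub p q) with exp-par (▸-par h q) e p
  ... | _ , p′ , e′ = _ , sub p′ q , subˡ e′
  exp-par h (subʳ e)   (sub p q) with exp-par h e q
  ... | _ , q′ , e′ = _ , sub p q′ , subʳ e′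
  -- The residual step starts from a weakening, so it does not replace the collected variable and
  -- descends to the smaller scope.
  exp-par h (subˡ e)   (gc g p refl q c) with exp-par (▸-par h q) e p
  ... | _ , p′ , e′ with exp-wk⁻¹ _ e′
  ... | _ , refl , e″ with exp-collectˡ c e″
  ... | _ , c′ , e‴ = _ , gc g p′ refl q c′ , e‴
  exp-par h (subʳ e)   (gc g p refl q c) with exp-par h e q
  ... | _ , q′ , e′ with exp-collectʳ c e′
  ... | _ , c′ , e″ = _ , gc g p refl q′ c′ , e″

-- Weak unfolding

-- The environment is meant to hold terms already unfolded: they are inserted as they are, which
-- keeps the recursion structural.
unfold : Env n → Term n → Term n
unfold σ (var x)     = σ x
unfold σ (ƛ t)       = ƛ t
unfold σ (t · u)     = unfold σ t · unfold σ u
unfold σ (t [x∖ u ]) = unfold (σ ▸ unfold σ u) t [x∖ unfold σ u ]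

unfold-rename : {ρ : Fin n → Fin m} {σ : Env n} {τ : Env m} → ρ ⊨ σ ∶ τ →
                ∀ t → unfold τ (rename ρ t) ≡ rename ρ (unfold σ t)
unfold-rename h (var x)     = h x
unfold-rename h (ƛ t)       = refl
unfold-rename h (t · u)     = cong₂ _·_ (unfold-rename h t) (unfold-rename h u)
unfold-rename h (t [x∖ u ]) =
  cong₂ _[x∖_] (unfold-rename (ext-⊨ h (unfold-rename h u)) t) (unfold-rename h u)

unfold-wk : (σ : Env n) (u t : Term n) → unfold (σ ▸ u) (wk t) ≡ wk (unfold σ t)
unfold-wk σ u = unfold-rename λ _ → refl

-- `σ` holds the values as they stand in the term and `τ` their unfoldings, so a variable and the
-- value replacing it unfold alike.
unfold-exp : {σ τ : Env n} → (∀ x → unfold τ (σ x) ≡ τ x) → {t t′ : Term n} →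
             σ ⊢ t ⇝ t′ → unfold τ t ≡ unfold τ t′
unfold-exp h (var refl) = sym (h _)
unfold-exp h (appˡ e)   = cong (_· _) (unfold-exp h e)
unfold-exp h (appʳ e)   = cong (_ ·_) (unfold-exp h e)
unfold-exp {σ = σ} {τ} h (subˡ {u = u} e) = cong _[x∖ _ ] (unfold-exp h′ e)
  where
  h′ : ∀ x → unfold (τ ▸ unfold τ u) ((σ ▸ u) x) ≡ (τ ▸ unfold τ u) x
  h′ zero    = unfold-wk τ _ u
  h′ (suc x) = trans (unfold-wk τ _ (σ x)) (cong wk (h x))
unfold-exp {τ = τ} h (subʳ {t = t} e) =
  cong (λ v → unfold (τ ▸ v) t [x∖ v ]) (unfold-exp h e)

exp-unfold : (σ : Env n) (t : Term n) → Star (σ ⊢_⇝_) t (unfold σ t)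
exp-unfold σ (var x)     = return (var refl)
exp-unfold σ (ƛ t)       = ε
exp-unfold σ (t · u)     =
  gmap (_· u) appˡ (exp-unfold σ t) ◅◅ gmap (unfold σ t ·_) appʳ (exp-unfold σ u)
exp-unfold σ (t [x∖ u ]) =
  -- The argument comes first, so that the steps in the body insert its unfolding.
  gmap (t [x∖_]) subʳ (exp-unfold σ u) ◅◅
  gmap _[x∖ unfold σ u ] subˡ (exp-unfold (σ ▸ unfold σ u) t)

unfold-exp⋆ : {t t′ : Term n} → Star (var ⊢_⇝_) t t′ → unfold var t ≡ unfold var t′
unfold-exp⋆ ε        = refl
unfold-exp⋆ (e ◅ es) = trans (unfold-exp (λ _ → refl) e) (unfold-exp⋆ es)

exp-confluent : Confluent (var {n} ⊢_⇝_)
exp-confluent {C = u} p q =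
  unfold var u ,
  subst (Star _ _) (trans (sym (unfold-exp⋆ p)) (unfold-exp⋆ q)) (exp-unfold var _) ,
  exp-unfold var u

exp-par-confluent : (G : Set) → Confluent ((var {n} ⊢_⇝_) ∪ Par G)
exp-par-confluent G =
  hindley-rosen exp-confluent (square-star par-diamond) (square-star (exp-par var))

-- Comparison with the weak closures of the root rules

-- One relation for both claims: `G = ⊤` admits garbage collection and `G = ⊥` excludes it.
data Root (G : Set) {n : ℕ} : Rel (Term n) 0ℓ where
  by-m   : ∀ {t u} → t ↦m u → Root G t u
  by-e   : ∀ {t u} → t ↦e u → Root G t u
  by-gcv : ∀ {t u} → G → t ↦gcv u → Root G t u

module _ {R : ∀ {k} → Rel (Term k) 0ℓ} where

  private
    _→R_ : Rel (Term n) 0ℓ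
    _→R_ = WeakClosure R

  close-appˡ : {t t′ u : Term n} → t →R t′ → (t · u) →R (t′ · u)
  close-appˡ (close W r) = close (W ·ˡ _) r

  close-appʳ : {t u u′ : Term n} → u →R u′ → (t · u) →R (t · u′)
  close-appʳ (close W r) = close (_ ·ʳ W) r

  close-subˡ : {t t′ : Term (suc n)} {u : Term n} → t →R t′ → (t [x∖ u ]) →R (t′ [x∖ u ])
  close-subˡ (close W r) = close (W [x∖ _ ]ˡ) r

  close-subʳ : {t : Term (suc n)} {u u′ : Term n} → u →R u′ → (t [x∖ u ]) →R (t [x∖ u′ ])
  close-subʳ (close W r) = close (_ [x∖ W ]ʳ) r

  close-app⋆ : {t t′ u u′ : Term n} → Star _→R_ t t′ → Star _→R_ u u′ →
               Star _→R_ (t · u) (t′ · u′)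
  close-app⋆ p q = gmap (_· _) close-appˡ p ◅◅ gmap (_ ·_) close-appʳ q

  close-sub⋆ : {t t′ : Term (suc n)} {u u′ : Term n} → Star _→R_ t t′ → Star _→R_ u u′ →
               Star _→R_ (t [x∖ u ]) (t′ [x∖ u′ ])
  close-sub⋆ p q = gmap _[x∖ _ ] close-subˡ p ◅◅ gmap (_ [x∖_]) close-subʳ q

∈fv-rename : (ρ : Fin n → Fin m) (t : Term n) {x : Fin m} → x ∈fv rename ρ t →
             ∃ λ y → ρ y ≡ x
∈fv-rename ρ (var y) var = y , refl
∈fv-rename ρ (ƛ t) (ƛ p) with ∈fv-rename (ext ρ) t p
... | suc y , eq = y , suc-injective eq
∈fv-rename ρ (t · u) (appˡ p) = ∈fv-rename ρ t p
∈fv-rename ρ (t · u) (appʳ p) = ∈fv-rename ρ u p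
∈fv-rename ρ (t [x∖ u ]) (subˡ p) with ∈fv-rename (ext ρ) t p
... | suc y , eq = y , suc-injective eq
∈fv-rename ρ (t [x∖ u ]) (subʳ p) = ∈fv-rename ρ u p

zero∉fv-wk : (t : Term n) → zero ∉fv wk t
zero∉fv-wk t p with ∈fv-rename suc t p
... | _ , ()

ext-punchIn : (x : Fin (suc n)) → ext (punchIn x) ≗ punchIn (suc x)
ext-punchIn x zero    = refl
ext-punchIn x (suc y) = refl

-- At `zero`, where `punchIn` is `suc`, this turns the side condition on free variables into being a
-- weakening.
rename-strengthen : (x : Fin (suc n)) (t : Term (suc n)) (x∉ : x ∉fv t) →
                    rename (punchIn x) (strengthen x t x∉) ≡ t
rename-strengthen x (var y) x∉ = cong var (punchIn-punchOut _)
rename-strengthen x (ƛ t) x∉ = cong ƛ_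
  (trans (rename-cong (ext-punchIn x) (strengthen (suc x) t _)) (rename-strengthen (suc x) t _))
rename-strengthen x (t · u) x∉ =
  cong₂ _·_ (rename-strengthen x t _) (rename-strengthen x u _)
rename-strengthen x (t [x∖ u ]) x∉ = cong₂ _[x∖_]
  (trans (rename-cong (ext-punchIn x) (strengthen (suc x) t _)) (rename-strengthen (suc x) t _))
  (rename-strengthen x u _)

beta-plug : (S : SCtx n m) (t : Term (suc m)) (u : Term n) →
            Beta (S ⟨ ƛ t ⟩ˢ) u (S ⟨ t [x∖ rename (embˢ S) u ] ⟩ˢ)
beta-plug ⟨·⟩ t u rewrite rename-id (λ _ → refl) u = lam
beta-plug (S [x∖ s ]) t u =
  sub (subst (λ v → Beta _ _ (S ⟨ t [x∖ v ] ⟩ˢ)) (rename-∘ (λ _ → refl) u) (beta-plug S t (wk u)))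

collect-plug : (t : Term n) (S : SCtx n m) {v : Term m} → Value v →
               Collect t (S ⟨ v ⟩ˢ) (S ⟪ t ⟫ˢ)
collect-plug t ⟨·⟩ (ƛ b) rewrite rename-id (λ _ → refl) t = lam
collect-plug t (S [x∖ s ]) v =
  sub (subst (λ w → Collect _ _ (S ⟨ w ⟩ˢ)) (rename-∘ (λ _ → refl) t) (collect-plug (wk t) S v))

-- Only the shape of `f` is recovered; the contractum then follows from `beta-plug` and determinism.
beta-plug⁻¹ : {f u r : Term n} → Beta f u r →
              ∃₂ λ m (S : SCtx n m) → ∃ λ t → f ≡ S ⟨ ƛ t ⟩ˢ
beta-plug⁻¹ lam     = _ , ⟨·⟩ , _ , refl
beta-plug⁻¹ (sub b) with beta-plug⁻¹ b
... | _ , S , t , refl = _ , S [x∖ _ ] , t , refl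

collect-plug⁻¹ : {t a r : Term n} → Collect t a r →
                 ∃₂ λ m (S : SCtx n m) → ∃ λ b → a ≡ S ⟨ ƛ b ⟩ˢ
collect-plug⁻¹ lam     = _ , ⟨·⟩ , _ , refl
collect-plug⁻¹ (sub c) with collect-plug⁻¹ c
... | _ , S , b , refl = _ , S [x∖ _ ] , b , refl

beta⇒↦m : {f u r : Term n} → Beta f u r → (f · u) ↦m r
beta⇒↦m {u = u} b with beta-plug⁻¹ b
... | _ , S , t , refl with beta-deterministic b (beta-plug S t u)
... | refl = root-m S t u

collect⇒↦gcv : {t a r : Term n} → Collect t a r → (wk t [x∖ a ]) ↦gcv r
collect⇒↦gcv {t = t} c with collect-plug⁻¹ c
... | _ , S , b , refl with collect-deterministic c (collect-plug t S (ƛ b))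
... | refl = subst (λ s → (wk t [x∖ S ⟨ ƛ b ⟩ˢ ]) ↦gcv (S ⟪ s ⟫ˢ))
                   (wk-injective (rename-strengthen zero (wk t) (zero∉fv-wk t)))
                   (root-gcv (wk t) S (ƛ b) (zero∉fv-wk t))

exp-plug : {σ : Env n} (W : WCtx n m) (x : Fin n) →
           σ ⊢ W ⟪ var x ⟫ʷ ⇝ W ⟪ σ x ⟫ʷ
exp-plug ⟨·⟩ x          = var (sym (rename-id (λ _ → refl) _))
exp-plug (W ·ˡ u) x     = appˡ (exp-plug W x)
exp-plug (t ·ʳ W) x     = appʳ (exp-plug W x)
exp-plug (t [x∖ W ]ʳ) x = subʳ (exp-plug W x)
exp-plug {σ = σ} (W [x∖ u ]ˡ) x =
  subˡ (subst (λ s → _ ⊢ _ ⇝ W ⟨ s ⟩ʷ) (rename-∘ (λ _ → refl) (σ x)) (exp-plug W (suc x)))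

↦e⇒exp : {σ : Env n} {t t′ : Term n} → t ↦e t′ → σ ⊢ t ⇝ t′
↦e⇒exp (root-e W u) = subˡ (exp-plug W zero)

-- A root exponential step replaces a variable bound inside the redex, so it is valid in every
-- environment, in particular in the one found at the hole.
exp-close : (W : WCtx n k) {t t′ : Term k} → (∀ {τ} → τ ⊢ t ⇝ t′) →
            ∀ {σ} → σ ⊢ W ⟨ t ⟩ʷ ⇝ W ⟨ t′ ⟩ʷ
exp-close ⟨·⟩          r = r
exp-close (W ·ˡ u)     r = appˡ (exp-close W r)
exp-close (t ·ʳ W)     r = appʳ (exp-close W r)
exp-close (t [x∖ W ]ʳ) r = subʳ (exp-close W r)
exp-close (W [x∖ u ]ˡ) r = subˡ (exp-close W r)

data Replacement {n : ℕ} (σ : Env n) : Rel (Term n) 0ℓ where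
  replace : (W : WCtx n m) (x : Fin n) {s : Term m} → rename (embʷ W) (σ x) ≡ s →
            Replacement σ (W ⟪ var x ⟫ʷ) (W ⟨ s ⟩ʷ)

-- Either the binder of the replaced variable lies inside the term, which gives a genuine step, or
-- the variable is free and its value comes from `σ`.
exp-plug⁻¹ : {σ : Env n} {t t′ : Term n} → σ ⊢ t ⇝ t′ → t →we t′ ⊎ Replacement σ t t′
exp-plug⁻¹ (var refl) = inj₂ (replace ⟨·⟩ _ (rename-id (λ _ → refl) _))
exp-plug⁻¹ (appˡ e) with exp-plug⁻¹ e
... | inj₁ r                = inj₁ (close-appˡ r)
... | inj₂ (replace W x eq) = inj₂ (replace (W ·ˡ _) x eq)
exp-plug⁻¹ (appʳ e) with exp-plug⁻¹ e
... | inj₁ r                = inj₁ (close-appʳ r)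
... | inj₂ (replace W x eq) = inj₂ (replace (_ ·ʳ W) x eq)
exp-plug⁻¹ (subʳ e) with exp-plug⁻¹ e
... | inj₁ r                = inj₁ (close-subʳ r)
... | inj₂ (replace W x eq) = inj₂ (replace (_ [x∖ W ]ʳ) x eq)
exp-plug⁻¹ {σ = σ} (subˡ e) with exp-plug⁻¹ e
... | inj₁ r                      = inj₁ (close-subˡ r)
-- The replaced variable meets its binder here, and the redex is complete.
... | inj₂ (replace W zero refl)  = inj₁ (close ⟨·⟩ (root-e W _))
... | inj₂ (replace W (suc x) eq) =
  inj₂ (replace (W [x∖ _ ]ˡ) x (trans (sym (rename-∘ (λ _ → refl) (σ x))) eq))

exp⇒we : {t t′ : Term n} → var ⊢ t ⇝ t′ → Star _→we_ t t′
exp⇒we e with exp-plug⁻¹ e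
... | inj₁ r                  = return r
-- The environment `var` replaces a free variable by itself.
... | inj₂ (replace W x refl) = ε

module _ {G : Set} where

  private
    _⟶_ : Rel (Term n) 0ℓ
    _⟶_ = WeakClosure (Root G)

  par⇒⟶ : {t t′ : Term n} → Par G t t′ → Star _⟶_ t t′
  par⇒⟶ (var x)      = ε
  par⇒⟶ (lam t)      = ε
  par⇒⟶ (app p q)    = close-app⋆ (par⇒⟶ p) (par⇒⟶ q)
  par⇒⟶ (sub p q)    = close-sub⋆ (par⇒⟶ p) (par⇒⟶ q)
  par⇒⟶ (beta p q b) =
    close-app⋆ (par⇒⟶ p) (par⇒⟶ q) ◅◅ return (close ⟨·⟩ (by-m (beta⇒↦m b)))
  par⇒⟶ (gc g p refl q c) =
    close-sub⋆ (par⇒⟶ p) (par⇒⟶ q) ◅◅ return (close ⟨·⟩ (by-gcv g (collect⇒↦gcv c)))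

  exp-par⇒⟶ : {t t′ : Term n} → ((var ⊢_⇝_) ∪ Par G) t t′ → Star _⟶_ t t′
  exp-par⇒⟶ (inj₁ r) = map (λ { (close W s) → close W (by-e s) }) (exp⇒we r)
  exp-par⇒⟶ (inj₂ p) = par⇒⟶ p

  ↦m⇒par : {t t′ : Term n} → t ↦m t′ → Par G t t′
  ↦m⇒par (root-m S t u) = beta (par-refl _) (par-refl _) (beta-plug S t u)

  ↦gcv⇒par : {t t′ : Term n} → G → t ↦gcv t′ → Par G t t′
  ↦gcv⇒par g (root-gcv t S v x∉t) =
    gc g (par-refl _) (sym (rename-strengthen zero t x∉t)) (par-refl _) (collect-plug _ S v)

  par-plug : (W : WCtx n k) {t t′ : Term k} → Par G t t′ → Par G (W ⟨ t ⟩ʷ) (W ⟨ t′ ⟩ʷ)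
  par-plug ⟨·⟩          p = p
  par-plug (W ·ˡ u)     p = app (par-plug W p) (par-refl u)
  par-plug (t ·ʳ W)     p = app (par-refl t) (par-plug W p)
  par-plug (t [x∖ W ]ʳ) p = sub (par-refl t) (par-plug W p)
  par-plug (W [x∖ u ]ˡ) p = sub (par-plug W p) (par-refl u)

  ⟶⇒exp-par : {t t′ : Term n} → t ⟶ t′ → ((var ⊢_⇝_) ∪ Par G) t t′
  ⟶⇒exp-par (close W (by-m r))     = inj₂ (par-plug W (↦m⇒par r))
  ⟶⇒exp-par (close W (by-e r))     = inj₁ (exp-close W (↦e⇒exp r))
  ⟶⇒exp-par (close W (by-gcv g r)) = inj₂ (par-plug W (↦gcv⇒par g r))

  ⟶-confluent : Confluent (_⟶_ {n})
  ⟶-confluent = confluent-transfer (λ r → return (⟶⇒exp-par r)) exp-par⇒⟶ (exp-par-confluent G)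

theorem4p8 : (n : ℕ) → Confluent (_→w_ {n}) × Confluent (_→w¬gcv_ {n})
theorem4p8 n =
  confluent-transfer
    (λ { (inj₁ (close W r))        → return (close W (by-m r))
       ; (inj₂ (inj₁ (close W r))) → return (close W (by-e r))
       ; (inj₂ (inj₂ (close W r))) → return (close W (by-gcv tt r)) })
    (λ { (close W (by-m r))     → return (inj₁ (close W r))
       ; (close W (by-e r))     → return (inj₂ (inj₁ (close W r)))
       ; (close W (by-gcv _ r)) → return (inj₂ (inj₂ (close W r))) })
    (⟶-confluent {G = ⊤}) ,
  confluent-transfer
    (λ { (inj₁ (close W r)) → return (close W (by-m r))
       ; (inj₂ (close W r)) → return (close W (by-e r)) })
    (λ { (close W (by-m r))     → return (inj₁ (close W r))
       ; (close W (by-e r))     → return (inj₂ (close W r)) })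
    (⟶-confluent {G = ⊥})
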